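{- Let $G$ be a graph. (1) If $n\geq 3$, then no two distinct vertices of $\uparrow^{n}G$ are strongly cospectral (with respect to the Laplacian). (2) Let $n=2$ and let $u$ be a vertex of $G$ with degree $d_u$. Then the vertices $(0,u)$ and $(1,u)$ are strongly cospectral in $\uparrow^{2}G$ if and only if $d_u\notin\sigma_u(G)$, in which case $$\sigma_{(0,u),(1,u)}^+(\uparrow^{2}G)=2\cdot \sigma_{u}(G)\quad \text{and}\quad \sigma_{(0,u),(1,u)}^-(\uparrow^{2}G)=\{2d_u\}.$$ Moreover, in $\uparrow^{2}G$ the vertex $(0,u)$ can be strongly cospectral only with $(1,u)$.
   Context: All graphs are simple, undirected and unweighted; $L=D-A$ is the Laplacian matrix of a graph, $d_u$ the degree of $u$. For a graph $X$, $\sigma(X)$ is the set of distinct Laplacian eigenvalues, $L(X)=\sum_{\lambda\in\sigma(X)}\lambda E_\lambda$ the spectral decomposition with orthogonal eigenprojections $E_\lambda$, and $\sigma_u(X)=\{\lambda\in\sigma(X):E_\lambda\mathbf{e}_u\neq\mathbf{0}\}$ is the eigenvalue support of vertex $u$. Two vertices $u,v$ of $X$ are strongly cospectral if $E_\lambda\mathbf{e}_u=\pm E_\lambda\mathbf{e}_v$ for every $\lambda\in\sigma_u(X)$; in that case $\sigma^+_{u,v}(X)=\{\lambda:E_\lambda\mathbf{e}_u=E_\lambda\mathbf{e}_v\neq\mathbf{0}\}$ and $\sigma^-_{u,v}(X)=\{\lambda:E_\lambda\mathbf{e}_u=-E_\lambda\mathbf{e}_v\neq\mathbf{0}\}$.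 For a set $S$, $2\cdot S=\{2s:s\in S\}$. The blow-up $\uparrow^{n}G$ has vertex set $\mathbb{Z}_n\times V(G)$, with $(l,u)\sim(m,v)$ iff $u\sim v$ in $G$. -}

module Defs where

open import Algebra.Bundles using (CommutativeRing)
import Algebra.Properties.CommutativeMonoid.Sum
import Algebra.Properties.Monoid.Mult
import Algebra.Properties.Ring
import Algebra.Properties.Semiring.Sum
open import Data.Bool.Base using (if_then_else_)
open import Data.Fin.Base using (Fin; zero; suc)
import Data.Fin.Properties as Fin
open import Data.List.Base using (List; []; _∷_; map; tabulate)
open import Data.List.Relation.Unary.All using (All; []; _∷_)
import Data.List.Relation.Unary.All.Properties as All
open import Data.Nat.Base as ℕ using (ℕ)
import Data.Nat.Properties as ℕ
open import Data.Product.Base using (Σ; ∃; _×_; _,_; proj₁; proj₂)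
open import Data.Product.Function.NonDependent.Propositional using (_×-↔_)
open import Data.Sum.Base using (_⊎_; inj₁; inj₂)
open import Function.Base using (_∘_)
open import Function.Bundles using (_↔_; Inverse)
open import Function.Construct.Composition using (_↔-∘_)
open import Function.Construct.Identity using (↔-id)
open import Function.Construct.Symmetry using (↔-sym)
open import Function.Properties.Inverse using (Inverse⇒Injection)
open import Level using (0ℓ; _⊔_) renaming (suc to lsuc)
open import Relation.Binary.Core using (Rel)
open import Relation.Binary.Definitions
  using (Decidable; DecidableEquality; Symmetric; tri<; tri≈; tri>)
open import Relation.Binary.PropositionalEquality.Core as ≡ using (_≡_)
import Relation.Binary.Reasoning.Setoid
open import Relation.Binary.Structures using (IsStrictTotalOrder)
open import Relation.Nullary.Decidable.Core using (does)
import Relation.Nullary.Decidable as Dec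
open import Relation.Nullary.Negation.Core using (¬_)
open import Relation.Unary using (Pred)

-- The real numbers, characterised up to isomorphism as the complete ordered
-- field.  The strict order is trichotomous, as in classical mathematics.
record CompleteOrderedField c ℓ₁ ℓ₂ : Set (lsuc (c ⊔ ℓ₁ ⊔ ℓ₂)) where
  infix 4 _<_ _≤_
  field
    commutativeRing : CommutativeRing c ℓ₁
  open CommutativeRing commutativeRing public
  field
    _<_                : Rel Carrier ℓ₂
    isStrictTotalOrder : IsStrictTotalOrder _≈_ _<_
    0<1                : 0# < 1#
    inverse            : ∀ x → ¬ x ≈ 0# → ∃ λ y → x * y ≈ 1#
    +-monoˡ-<          : ∀ z {x y} → x < y → x + z < y + z
    *-pos              : ∀ {x y} → 0# < x → 0# < y → 0# < x * y

  _≤_ : Rel Carrier ℓ₂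
  x ≤ y = ¬ y < x

  UpperBound : ∀ {p} → Pred Carrier p → Pred Carrier _
  UpperBound P b = ∀ x → P x → x ≤ b

  field
    supremum : (P : Pred Carrier (c ⊔ ℓ₁ ⊔ ℓ₂)) → ∃ P → ∃ (UpperBound P) →
               ∃ λ s → UpperBound P s × (∀ b → UpperBound P b → s ≤ b)

record Graph : Set₁ where
  infix 4 _∼_ _∼?_
  field
    Vertex   : Set
    order    : ℕ
    vertices : Vertex ↔ Fin order
    _∼_      : Rel Vertex 0ℓ
    _∼?_     : Decidable _∼_
    ∼-sym    : Symmetric _∼_
    ∼-irrefl : ∀ u → ¬ u ∼ u

  vertex : Fin order → Vertex
  vertex = Inverse.from vertices

  _≟_ : DecidableEquality Vertex
  _≟_ = Dec.via-injection (Inverse⇒Injection vertices) Fin._≟_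

  degree : Vertex → ℕ
  degree u = sum λ i → if does (u ∼? vertex i) then 1 else 0
    where open Algebra.Properties.CommutativeMonoid.Sum ℕ.+-0-commutativeMonoid

open Graph using (Vertex)

-- The blow-up; ℤₙ occurs only as an index set, so it is represented by Fin n.
↑ : ℕ → Graph → Graph
↑ n G = record
  { Vertex   = Fin n × Vertex G
  ; order    = n ℕ.* order
  ; vertices = ↔-sym Fin.*↔× ↔-∘ (↔-id (Fin n) ×-↔ vertices)
  ; _∼_      = λ x y → proj₂ x ∼ proj₂ y
  ; _∼?_     = λ x y → proj₂ x ∼? proj₂ y
  ; ∼-sym    = ∼-sym
  ; ∼-irrefl = λ x → ∼-irrefl (proj₂ x)
  }
  where open Graph G using (order; vertices; _∼_; _∼?_; ∼-sym; ∼-irrefl)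

module Laplacian {c ℓ₁ ℓ₂} (ℝ : CompleteOrderedField c ℓ₁ ℓ₂) where

  open CompleteOrderedField ℝ hiding (zero)
  open Algebra.Properties.Monoid.Mult +-monoid using () renaming (_×_ to _×ᴿ_)
  open Algebra.Properties.Semiring.Sum semiring
    using (sum; sum-cong-≋; sum-replicate-zero; ∑-distrib-+; *-distribˡ-sum)

  fromℕ : ℕ → Carrier
  fromℕ n = n ×ᴿ 1#

  module _ (X : Graph) where
    open Graph X using (order; vertex; vertices; _≟_; _∼?_; degree)

    ℝᵛ : Set c
    ℝᵛ = Vertex X → Carrier

    Matrix : Set c
    Matrix = Vertex X → Vertex X → Carrier

    infix 4 _≋_
    _≋_ : Rel ℝᵛ ℓ₁
    x ≋ y = ∀ u → x u ≈ y u

    0ᵛ : ℝᵛ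
    0ᵛ _ = 0#

    infix 8 -ᵛ_
    -ᵛ_ : ℝᵛ → ℝᵛ
    (-ᵛ x) u = - x u

    infixl 6 _-ᵛ_
    _-ᵛ_ : ℝᵛ → ℝᵛ → ℝᵛ
    (x -ᵛ y) u = x u - y u

    infixr 7 _•_
    _•_ : Carrier → ℝᵛ → ℝᵛ
    (a • x) u = a * x u

    infix 8 _∙_
    _∙_ : ℝᵛ → ℝᵛ → Carrier
    x ∙ y = sum λ i → x (vertex i) * y (vertex i)

    infixr 9 _·_
    _·_ : Matrix → ℝᵛ → ℝᵛ
    (M · x) u = M u ∙ x

    e : Vertex X → ℝᵛ
    e u v = if does (u ≟ v) then 1# else 0#

    D : Matrix
    D u v = if does (u ≟ v) then fromℕ (degree u) else 0#

    A : Matrix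
    A u v = if does (u ∼? v) then 1# else 0#

    L : Matrix
    L u v = D u v - A u v

    Eigenspace : Carrier → Pred ℝᵛ ℓ₁
    Eigenspace λ′ x = L · x ≋ λ′ • x

    record IsOrthogonalProjection {w} (W : Pred ℝᵛ w) (P : Matrix) :
                                  Set (c ⊔ ℓ₁ ⊔ w) where
      field
        range      : ∀ x → W (P · x)
        orthogonal : ∀ x w → W w → (x -ᵛ P · x) ∙ w ≈ 0#

    private
      module ≈-R = Relation.Binary.Reasoning.Setoid setoid
      open Algebra.Properties.Ring ring
        using (-‿distribˡ-*; -‿distribʳ-*; -0#≈0#)
      open IsOrthogonalProjection

      ∙-congˡ : ∀ x {y z} → y ≋ z → x ∙ y ≈ x ∙ z
      ∙-congˡ x p = sum-cong-≋ λ i → *-congˡ {x (vertex i)} (p (vertex i))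

      ∙-congʳ : ∀ x {y z} → y ≋ z → y ∙ x ≈ z ∙ x
      ∙-congʳ x p = sum-cong-≋ λ i → *-congʳ {x (vertex i)} (p (vertex i))

      ∙-comm : ∀ x y → x ∙ y ≈ y ∙ x
      ∙-comm x y = sum-cong-≋ λ i → *-comm (x (vertex i)) (y (vertex i))

      infixl 6 _+ᵛ_
      _+ᵛ_ : ℝᵛ → ℝᵛ → ℝᵛ
      (x +ᵛ y) u = x u + y u

      ∙-+ : ∀ x y z → x ∙ (y +ᵛ z) ≈ x ∙ y + x ∙ z
      ∙-+ x y z = trans
        (sum-cong-≋ λ i → distribˡ (x (vertex i)) (y (vertex i)) (z (vertex i)))
        (∑-distrib-+ (λ i → x (vertex i) * y (vertex i))
                     (λ i → x (vertex i) * z (vertex i)))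

      ∙-• : ∀ x a y → x ∙ (a • y) ≈ a * x ∙ y
      ∙-• x a y = trans
        (sum-cong-≋ λ i → swap (x (vertex i)) a (y (vertex i)))
        (sym (*-distribˡ-sum a (λ i → x (vertex i) * y (vertex i))))
        where
        swap : ∀ p q r → p * (q * r) ≈ q * (p * r)
        swap p q r = trans (sym (*-assoc p q r))
                       (trans (*-congʳ (*-comm p q)) (*-assoc q p r))

      -‿as-* : ∀ a → - 1# * a ≈ - a
      -‿as-* a = trans (sym (-‿distribˡ-* 1# a)) (-‿cong (*-identityˡ a))

      ∙-- : ∀ x y z → x ∙ (y -ᵛ z) ≈ x ∙ y - x ∙ z
      ∙-- x y z = begin
        x ∙ (y -ᵛ z)            ≈⟨ ∙-congˡ x (λ u → +-congˡ {y u} (-‿as-* (z u))) ⟨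
        x ∙ (y +ᵛ (- 1#) • z)   ≈⟨ ∙-+ x y ((- 1#) • z) ⟩
        x ∙ y + x ∙ ((- 1#) • z) ≈⟨ +-congˡ (∙-• x (- 1#) z) ⟩
        x ∙ y + - 1# * x ∙ z    ≈⟨ +-congˡ (-‿as-* (x ∙ z)) ⟩
        x ∙ y - x ∙ z           ∎
        where open ≈-R

      -‿∙ : ∀ x y z → (x -ᵛ y) ∙ z ≈ x ∙ z - y ∙ z
      -‿∙ x y z = trans (∙-comm (x -ᵛ y) z)
        (trans (∙-- z x y) (+-cong (∙-comm z x) (-‿cong (∙-comm z y))))

      •-∙ : ∀ a x y → (a • x) ∙ y ≈ a * x ∙ y
      •-∙ a x y = trans (∙-comm (a • x) y)
        (trans (∙-• y a x) (*-congˡ (∙-comm y x)))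

      x-y≈0⇒x≈y : ∀ {x y} → x - y ≈ 0# → x ≈ y
      x-y≈0⇒x≈y {x} {y} p = begin
        x             ≈⟨ +-identityʳ x ⟨
        x + 0#        ≈⟨ +-congˡ (-‿inverseˡ y) ⟨
        x + (- y + y) ≈⟨ +-assoc x (- y) y ⟨
        x - y + y     ≈⟨ +-congʳ p ⟩
        0# + y        ≈⟨ +-identityˡ y ⟩
        y             ∎
        where open ≈-R

      x≈y⇒x-y≈0 : ∀ {x y} → x ≈ y → x - y ≈ 0#
      x≈y⇒x-y≈0 {x} {y} p = trans (+-congʳ p) (-‿inverseʳ y)

      module _ where
        open IsStrictTotalOrder isStrictTotalOrder
          using (compare; <-respʳ-≈; <-respˡ-≈; irrefl)
          renaming (trans to <-trans)

        neg-pos : ∀ {x} → x < 0# → 0# < - x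
        neg-pos {x} p = <-respˡ-≈ (-‿inverseʳ x)
                          (<-respʳ-≈ (+-identityˡ (- x)) (+-monoˡ-< (- x) p))

        sq-cases : ∀ x → x ≈ 0# ⊎ 0# < x * x
        sq-cases x with compare x 0#
        ... | tri≈ _ p _ = inj₁ p
        ... | tri> _ _ p = inj₂ (*-pos p p)
        ... | tri< p _ _ = inj₂ (<-respʳ-≈ eq (*-pos (neg-pos p) (neg-pos p)))
          where
          open Algebra.Properties.Ring ring using (-‿involutive)
          eq : - x * - x ≈ x * x
          eq = trans (sym (-‿distribˡ-* x (- x)))
                 (trans (-‿cong (sym (-‿distribʳ-* x x))) (-‿involutive (x * x)))

        +-pos : ∀ {x y} → 0# < x → 0# < y → 0# < x + y
        +-pos {x} {y} p q =
          <-trans q (<-respˡ-≈ (+-identityˡ y) (+-monoˡ-< y p))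

        sumsq : ∀ {n} (f : Fin n → Carrier) →
                (∀ i → f i ≈ 0#) ⊎ 0# < sum (λ i → f i * f i)
        sumsq {ℕ.zero}  f = inj₁ λ ()
        sumsq {ℕ.suc n} f with sq-cases (f zero) | sumsq (f ∘ suc)
        ... | inj₁ p | inj₁ q = inj₁ λ { zero → p ; (suc i) → q i }
        ... | inj₁ p | inj₂ q = inj₂ (<-respʳ-≈ (sym (trans (+-congʳ
                (trans (*-congʳ p) (zeroˡ (f zero)))) (+-identityˡ _))) q)
        ... | inj₂ p | inj₁ q = inj₂ (<-respʳ-≈ (sym (trans (+-congˡ
                (trans (sum-cong-≋ λ i → trans (*-congʳ (q i)) (zeroˡ (f (suc i))))
                  (sum-replicate-zero n))) (+-identityʳ _))) p)
        ... | inj₂ p | inj₂ q = inj₂ (+-pos p q)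

        definite : ∀ x → x ≋ 0ᵛ ⊎ ¬ x ∙ x ≈ 0#
        definite x with sumsq (x ∘ vertex)
        ... | inj₁ p = inj₁ λ u → ≡.subst (λ v → x v ≈ 0#)
                (Inverse.strictlyInverseʳ vertices u) (p (Inverse.to vertices u))
        ... | inj₂ p = inj₂ λ q → irrefl (sym q) p

      sum-δ : ∀ {n} (j : Fin n) (f d : Fin n → Carrier) → d j ≈ 1# →
              (∀ i → ¬ i ≡ j → d i ≈ 0#) → sum (λ i → d i * f i) ≈ f j
      sum-δ {ℕ.suc n} zero f d p q = begin
        d zero * f zero + sum (λ i → d (suc i) * f (suc i))
          ≈⟨ +-cong (trans (*-congʳ p) (*-identityˡ _))
               (trans (sum-cong-≋ λ i → trans (*-congʳ (q (suc i) λ ())) (zeroˡ (f (suc i))))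
                 (sum-replicate-zero n)) ⟩
        f zero + 0# ≈⟨ +-identityʳ _ ⟩
        f zero ∎
        where open ≈-R
      sum-δ {ℕ.suc n} (suc j) f d p q = begin
        d zero * f zero + sum (λ i → d (suc i) * f (suc i))
          ≈⟨ +-cong (trans (*-congʳ (q zero λ ())) (zeroˡ _))
               (sum-δ j (f ∘ suc) (d ∘ suc) p λ i i≢j → q (suc i) λ { ≡.refl → i≢j ≡.refl }) ⟩
        0# + f (suc j) ≈⟨ +-identityˡ _ ⟩
        f (suc j) ∎
        where open ≈-R

      e-∙ : ∀ u x → e u ∙ x ≈ x u
      e-∙ u x = trans
        (sum-δ (to u) (x ∘ vertex) (e u ∘ vertex) at-u off-u)
        (reflexive (≡.cong x (strictlyInverseʳ u)))
        where
        open Inverse vertices using (to; strictlyInverseʳ; strictlyInverseˡ)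
        at-u : e u (vertex (to u)) ≈ 1#
        at-u = reflexive (≡.cong (if_then 1# else 0#)
          (Dec.dec-true (u ≟ vertex (to u)) (≡.sym (strictlyInverseʳ u))))
        off-u : ∀ i → ¬ i ≡ to u → e u (vertex i) ≈ 0#
        off-u i i≢u = reflexive (≡.cong (if_then 1# else 0#)
          (Dec.dec-false (u ≟ vertex i) λ p →
            i≢u (≡.trans (≡.sym (strictlyInverseˡ i)) (≡.cong to (≡.sym p)))))

      Kernel : List ℝᵛ → Pred ℝᵛ _
      Kernel rs x = All (λ r → r ∙ x ≈ 0#) rs

      kernel-- : ∀ {rs} x y → Kernel rs x → Kernel rs y → Kernel rs (x -ᵛ y)
      kernel-- x y [] [] = []
      kernel-- {r ∷ _} x y (p ∷ ps) (q ∷ qs) =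
        trans (∙-- r x y) (x≈y⇒x-y≈0 (trans p (sym q))) ∷ kernel-- x y ps qs

      kernel-• : ∀ {rs} a x → Kernel rs x → Kernel rs (a • x)
      kernel-• a x [] = []
      kernel-• {r ∷ _} a x (p ∷ ps) =
        trans (∙-• r a x) (trans (*-congˡ p) (zeroʳ a)) ∷ kernel-• a x ps

      kernel-≋ : ∀ {rs x y} → x ≋ y → Kernel rs y → Kernel rs x
      kernel-≋ x≋y [] = []
      kernel-≋ {r ∷ _} x≋y (p ∷ ps) = trans (∙-congˡ r x≋y) p ∷ kernel-≋ x≋y ps

      -- Adding the condition r ∙ x ≈ 0 to W removes from W the direction of
      -- the projection of r to W.
      kernelProjection : ∀ rs → Σ Matrix (IsOrthogonalProjection (Kernel rs))
      kernelProjection [] = e , record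
        { range      = λ _ → []
        ; orthogonal = λ x w _ → begin
            (x -ᵛ e · x) ∙ w ≈⟨ ∙-congʳ w (λ u → x≈y⇒x-y≈0 (sym (e-∙ u x))) ⟩
            0ᵛ ∙ w           ≈⟨ sum-cong-≋ (λ i → zeroˡ (w (vertex i))) ⟩
            sum {order} (λ _ → 0#) ≈⟨ sum-replicate-zero order ⟩
            0# ∎
        }
        where open ≈-R
      kernelProjection (r ∷ rs) with kernelProjection rs
      ... | P , isP = step (definite q)
        where
        open ≈-R
        q : ℝᵛ
        q = P · r

        project : ∀ x w → Kernel rs w → x ∙ w ≈ (P · x) ∙ w
        project x w Ww = x-y≈0⇒x≈y
          (trans (sym (-‿∙ x (P · x) w)) (orthogonal isP x w Ww))

        r∙P : ∀ x → r ∙ (P · x) ≈ q ∙ x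
        r∙P x = begin
          r ∙ (P · x)       ≈⟨ project r (P · x) (range isP x) ⟩
          q ∙ (P · x)       ≈⟨ ∙-comm q (P · x) ⟩
          (P · x) ∙ q       ≈⟨ project x q (range isP r) ⟨
          x ∙ q             ≈⟨ ∙-comm x q ⟩
          q ∙ x             ∎

        step : q ≋ 0ᵛ ⊎ ¬ q ∙ q ≈ 0# →
               Σ Matrix (IsOrthogonalProjection (Kernel (r ∷ rs)))
        step (inj₁ q≋0) = P , record
          { range      = λ x → (begin
              r ∙ (P · x) ≈⟨ r∙P x ⟩
              q ∙ x       ≈⟨ ∙-congʳ x q≋0 ⟩
              0ᵛ ∙ x      ≈⟨ sum-cong-≋ (λ i → zeroˡ (x (vertex i))) ⟩
              sum {order} (λ _ → 0#) ≈⟨ sum-replicate-zero order ⟩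
              0# ∎) ∷ range isP x
          ; orthogonal = λ { x w (_ ∷ Ww) → orthogonal isP x w Ww }
          }
        step (inj₂ q∙q≉0) = P′ , record
          { range      = λ x →
              (begin
                r ∙ (P′ · x)                ≈⟨ ∙-congˡ r (P′· x) ⟩
                r ∙ (P · x -ᵛ k x • q)      ≈⟨ ∙-- r (P · x) (k x • q) ⟩
                r ∙ (P · x) - r ∙ (k x • q) ≈⟨ x≈y⇒x-y≈0 (begin
                  r ∙ (P · x)      ≈⟨ r∙P x ⟩
                  q ∙ x            ≈⟨ *-identityˡ _ ⟨
                  1# * q ∙ x       ≈⟨ *-congʳ c-inv ⟨
                  q ∙ q * c′ * q ∙ x ≈⟨ *-assoc _ _ _ ⟩
                  q ∙ q * k x      ≈⟨ *-comm _ _ ⟩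
                  k x * q ∙ q      ≈⟨ *-congˡ (project r q (range isP r)) ⟨
                  k x * r ∙ q      ≈⟨ ∙-• r (k x) q ⟨
                  r ∙ (k x • q)    ∎) ⟩
                0# ∎)
              ∷ kernel-≋ (P′· x)
                  (kernel-- (P · x) (k x • q) (range isP x) (kernel-• (k x) q (range isP r)))
          ; orthogonal = λ { x w (r∙w ∷ Ww) → begin
              (x -ᵛ P′ · x) ∙ w         ≈⟨ -‿∙ x (P′ · x) w ⟩
              x ∙ w - (P′ · x) ∙ w      ≈⟨ x≈y⇒x-y≈0 (begin
                x ∙ w                   ≈⟨ project x w Ww ⟩
                (P · x) ∙ w             ≈⟨ +-identityʳ _ ⟨
                (P · x) ∙ w + 0#        ≈⟨ +-congˡ -0#≈0# ⟨
                (P · x) ∙ w - 0#        ≈⟨ +-congˡ (-‿cong (zeroʳ (k x))) ⟨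
                (P · x) ∙ w - k x * 0#  ≈⟨ +-congˡ (-‿cong (*-congˡ r∙w)) ⟨
                (P · x) ∙ w - k x * r ∙ w ≈⟨ +-congˡ (-‿cong (*-congˡ (project r w Ww))) ⟩
                (P · x) ∙ w - k x * q ∙ w ≈⟨ +-congˡ (-‿cong (•-∙ (k x) q w)) ⟨
                (P · x) ∙ w - (k x • q) ∙ w ≈⟨ -‿∙ (P · x) (k x • q) w ⟨
                (P · x -ᵛ k x • q) ∙ w  ≈⟨ ∙-congʳ w (P′· x) ⟨
                (P′ · x) ∙ w            ∎) ⟩
              0# ∎ }
          }
          where
          c′ : Carrier
          c′ = proj₁ (inverse (q ∙ q) q∙q≉0)
          c-inv : q ∙ q * c′ ≈ 1#
          c-inv = proj₂ (inverse (q ∙ q) q∙q≉0)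
          P′ : Matrix
          P′ u v = P u v - (c′ * q u) * q v
          k : ℝᵛ → Carrier
          k x = c′ * q ∙ x
          P′· : ∀ x → P′ · x ≋ P · x -ᵛ k x • q
          P′· x u = begin
            (P u -ᵛ (c′ * q u) • q) ∙ x       ≈⟨ -‿∙ (P u) ((c′ * q u) • q) x ⟩
            P u ∙ x - ((c′ * q u) • q) ∙ x    ≈⟨ +-congˡ (-‿cong (begin
              ((c′ * q u) • q) ∙ x  ≈⟨ •-∙ (c′ * q u) q x ⟩
              c′ * q u * q ∙ x      ≈⟨ *-assoc _ _ _ ⟩
              c′ * (q u * q ∙ x)    ≈⟨ *-congˡ (*-comm _ _) ⟩
              c′ * (q ∙ x * q u)    ≈⟨ *-assoc _ _ _ ⟨
              k x * q u             ∎)) ⟩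
            P u ∙ x - k x * q u               ∎

      row : Carrier → Vertex X → ℝᵛ
      row λ′ u = L u -ᵛ λ′ • e u

      rows : Carrier → List ℝᵛ
      rows λ′ = tabulate (row λ′ ∘ vertex)

      row-∙ : ∀ λ′ u x → row λ′ u ∙ x ≈ (L · x) u - λ′ * x u
      row-∙ λ′ u x = trans (-‿∙ (L u) (λ′ • e u) x)
        (+-congˡ (-‿cong (trans (•-∙ λ′ (e u) x) (*-congˡ (e-∙ u x)))))

      kernel⇒eigenspace : ∀ λ′ x → Kernel (rows λ′) x → Eigenspace λ′ x
      kernel⇒eigenspace λ′ x p u = x-y≈0⇒x≈y (trans (sym (row-∙ λ′ u x))
        (≡.subst (λ v → row λ′ v ∙ x ≈ 0#) (Inverse.strictlyInverseʳ vertices u)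
          (All.tabulate⁻ p (Inverse.to vertices u))))

      eigenspace⇒kernel : ∀ λ′ x → Eigenspace λ′ x → Kernel (rows λ′) x
      eigenspace⇒kernel λ′ x p = All.tabulate⁺ λ i →
        trans (row-∙ λ′ (vertex i) x) (x≈y⇒x-y≈0 (p (vertex i)))

    -- E λ′ is the coefficient of λ′ in the spectral decomposition of L: the
    -- orthogonal projection to the λ′-eigenspace.  It is zero if λ′ ∉ σ.
    eigenprojection : ∀ λ′ → Σ Matrix (IsOrthogonalProjection (Eigenspace λ′))
    eigenprojection λ′ with kernelProjection (rows λ′)
    ... | P , isP = P , record
      { range      = λ x → kernel⇒eigenspace λ′ (P · x) (range isP x)
      ; orthogonal = λ x w p → orthogonal isP x w (eigenspace⇒kernel λ′ w p)
      }

    E : Carrier → Matrix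
    E λ′ = proj₁ (eigenprojection λ′)

    σ : Pred Carrier (c ⊔ ℓ₁)
    σ λ′ = ∃ λ x → ¬ x ≋ 0ᵛ × Eigenspace λ′ x

    support : Vertex X → Pred Carrier (c ⊔ ℓ₁)
    support u λ′ = σ λ′ × ¬ E λ′ · e u ≋ 0ᵛ

    StronglyCospectral : Vertex X → Vertex X → Set (c ⊔ ℓ₁)
    StronglyCospectral u v = ∀ λ′ → support u λ′ →
      E λ′ · e u ≋ E λ′ · e v ⊎ E λ′ · e u ≋ -ᵛ (E λ′ · e v)

    σ⁺ : Vertex X → Vertex X → Pred Carrier (c ⊔ ℓ₁)
    σ⁺ u v λ′ = σ λ′ × E λ′ · e u ≋ E λ′ · e v × ¬ E λ′ · e u ≋ 0ᵛ

    σ⁻ : Vertex X → Vertex X → Pred Carrier (c ⊔ ℓ₁)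
    σ⁻ u v λ′ = σ λ′ × E λ′ · e u ≋ -ᵛ (E λ′ · e v) × ¬ E λ′ · e u ≋ 0ᵛ

  infixr 7 2·_
  2·_ : ∀ {p} → Pred Carrier p → Pred Carrier (c ⊔ ℓ₁ ⊔ p)
  (2· S) x = ∃ λ s → S s × x ≈ fromℕ 2 * s

  ｛_｝ : Carrier → Pred Carrier ℓ₁
  ｛ a ｝ x = x ≈ a

{-# OPTIONS --safe #-}
module Submission where

-- Since E_λ e_u represents the functional w ↦ w u on the λ-eigenspace, the
-- condition E_λ e_u = ± E_λ e_v says that w u = ± w v for every w in it, so
-- only eigenvectors have to be understood.  In the blow-up,
--   (L x)(l,v) = n d_v x(l,v) − (A s)(v),  where s(v) = Σ_l x(l,v).
-- Hence e_(l,u) − e_(k,u) is an eigenvector for n d_u.  It vanishes outside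
-- {(l,u), (k,u)}, so (l,u) can be strongly cospectral only with (k,u); for
-- n ≥ 3 there are two choices of k.  For n = 2 an eigenvector takes equal
-- values on (0,u) and (1,u) unless its eigenvalue is 2 d_u, in which case it
-- takes opposite values unless s is an eigenvector of G for d_u that is
-- nonzero at u.

open import Defs
open import Algebra.Bundles using (CommutativeMonoid)
import Algebra.Properties.CommutativeMonoid.Sum
import Algebra.Properties.Ring
import Algebra.Properties.Semiring.Mult
import Algebra.Properties.Semiring.Sum
open import Data.Bool.Base using (Bool; true; false; if_then_else_)
open import Data.Fin.Base using (Fin; suc; _↑ˡ_; _↑ʳ_; combine; punchIn)
open import Data.Fin.Patterns using (0F; 1F; 2F)
import Data.Fin.Properties as Fin
open import Data.Nat.Base as ℕ using (ℕ; NonZero; _≥_)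
import Data.Nat.Properties as ℕ
open import Data.Product.Base using (∃; _×_; _,_; proj₁; proj₂)
open import Data.Sum.Base using (inj₁; inj₂)
open import Function.Base using (_∘_)
open import Function.Bundles using (_⇔_; Equivalence; Inverse; mk⇔)
open import Relation.Binary.PropositionalEquality.Core as ≡ using (_≡_; _≢_)
import Relation.Binary.Reasoning.Setoid
open import Relation.Binary.Structures using (IsStrictTotalOrder)
open import Relation.Nullary.Decidable.Core using (Dec; does; yes; no)
import Relation.Nullary.Decidable as Dec
open import Relation.Nullary.Negation.Core using (¬_; contradiction)
open import Relation.Unary using (_≐_; _∉_)
open Graph using (Vertex; degree)

-- With at least three copies, the copy of the first vertex can be paired with one that also differs
-- from the copy of the second vertex.
avoid₂ : ∀ {n} (i j : Fin (3 ℕ.+ n)) → ∃ λ k → i ≢ k × j ≢ k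
avoid₂ 0F            0F            = 1F , (λ ()) , (λ ())
avoid₂ 0F            1F            = 2F , (λ ()) , (λ ())
avoid₂ 0F            (suc (suc _)) = 1F , (λ ()) , (λ ())
avoid₂ 1F            0F            = 2F , (λ ()) , (λ ())
avoid₂ (suc (suc _)) 0F            = 1F , (λ ()) , (λ ())
avoid₂ (suc _)       (suc _)       = 0F , (λ ()) , (λ ())

-- Sums over the vertices of a blow-up, and its degrees.

module _ {a ℓ} (M : CommutativeMonoid a ℓ) where
  open CommutativeMonoid M
  open Algebra.Properties.CommutativeMonoid.Sum M using (sum; sum-cong-≗)

  sum-++ : ∀ m {n} (f : Fin (m ℕ.+ n) → Carrier) →
           sum f ≈ sum (λ i → f (i ↑ˡ n)) ∙ sum (λ j → f (m ↑ʳ j))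
  sum-++ ℕ.zero    f = sym (identityˡ _)
  sum-++ (ℕ.suc m) f = trans (∙-congˡ (sum-++ m (f ∘ suc))) (sym (assoc _ _ _))

  sum-combine : ∀ m {n} (f : Fin (m ℕ.* n) → Carrier) →
                sum f ≈ sum {m} (λ i → sum {n} λ j → f (combine i j))
  sum-combine ℕ.zero        f = refl
  sum-combine (ℕ.suc m) {n} f =
    trans (sum-++ n f) (∙-congˡ (sum-combine m (λ i → f (n ↑ʳ i))))

  -- The blow-up enumerates its vertices by decoding an index with `remQuot`, which undoes
  -- `combine l j`. A general commutative monoid is taken because both the degrees in ℕ and the
  -- matrix products over the field are sums of this kind.
  sum-vertex-↑ : ∀ n G (f : Vertex (↑ n G) → Carrier) →
                 sum (f ∘ Graph.vertex (↑ n G)) ≈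
                 sum {n} (λ l → sum λ j → f (l , Graph.vertex G j))
  sum-vertex-↑ n G f = trans
    (sum-combine n (f ∘ Graph.vertex (↑ n G)))
    (reflexive (sum-cong-≗ {n} λ l → sum-cong-≗ λ j →
      ≡.cong (λ (l , j) → f (l , Graph.vertex G j)) (Fin.remQuot-combine l j)))

module _ where
  open Algebra.Properties.CommutativeMonoid.Sum ℕ.+-0-commutativeMonoid

  sum-const-ℕ : ∀ n d → sum {n} (λ _ → d) ≡ n ℕ.* d
  sum-const-ℕ ℕ.zero    d = ≡.refl
  sum-const-ℕ (ℕ.suc n) d = ≡.cong (d ℕ.+_) (sum-const-ℕ n d)

  degree-↑ : ∀ n G l u → degree (↑ n G) (l , u) ≡ n ℕ.* degree G u
  degree-↑ n G l u = ≡.trans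
    (sum-vertex-↑ ℕ.+-0-commutativeMonoid n G λ v →
      if does (Graph._∼?_ G u (proj₂ v)) then 1 else 0)
    (sum-const-ℕ n (degree G u))

-- Arithmetic and finite sums in the field.

module _ {c ℓ₁ ℓ₂} (ℝ : CompleteOrderedField c ℓ₁ ℓ₂) where

  open CompleteOrderedField ℝ hiding (zero)
  open Algebra.Properties.Ring ring
  open Algebra.Properties.Semiring.Sum semiring
  open Algebra.Properties.Semiring.Mult semiring
    using (×-assoc-*; ×-congʳ; ×1-homo-*) renaming (_×_ to _×ᴿ_)
  open IsStrictTotalOrder isStrictTotalOrder
    using (<-respʳ-≈; <-respˡ-≈; irrefl)
    renaming (trans to <-trans; _≟_ to _≈?_)
  open Relation.Binary.Reasoning.Setoid setoid
  open Laplacian ℝ using (fromℕ; Eigenspace; ℝᵛ; L; A; D; E; e; support;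
    StronglyCospectral; σ⁺; σ⁻; 2·_; ｛_｝)

  -- Trichotomy makes equality decidable, so equations may be proved by contradiction. This is how
  -- non-membership in a support yields that a value is zero.
  ≈-stable : ∀ {x y} → ¬ ¬ x ≈ y → x ≈ y
  ≈-stable {x} {y} = Dec.decidable-stable (x ≈? y)

  1≉0 : ¬ 1# ≈ 0#
  1≉0 p = irrefl (sym p) 0<1

  0<fromℕ : ∀ n → 0# < fromℕ (ℕ.suc n)
  0<fromℕ ℕ.zero    = <-respʳ-≈ (sym (+-identityʳ 1#)) 0<1
  0<fromℕ (ℕ.suc n) = <-trans (0<fromℕ n)
    (<-respˡ-≈ (+-identityˡ _) (+-monoˡ-< (fromℕ (ℕ.suc n)) 0<1))

  -- An ordered field has characteristic zero; this is what permits cancelling the number of copies.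
  fromℕ≉0 : ∀ n → .{{NonZero n}} → ¬ fromℕ n ≈ 0#
  fromℕ≉0 (ℕ.suc n) p = irrefl (sym p) (0<fromℕ n)

  *-cancelˡ : ∀ {a x y} → ¬ a ≈ 0# → a * x ≈ a * y → x ≈ y
  *-cancelˡ {a} {x} {y} a≉0 p with inverse a a≉0
  ... | b , ab≈1 = begin
    x           ≈⟨ undo x ⟨
    b * (a * x) ≈⟨ *-congˡ p ⟩
    b * (a * y) ≈⟨ undo y ⟩
    y           ∎
    where
    undo : ∀ z → b * (a * z) ≈ z
    undo z = trans (sym (*-assoc b a z))
      (trans (*-congʳ (trans (*-comm b a) ab≈1)) (*-identityˡ z))

  fromℕ-* : ∀ n x → n ×ᴿ x ≈ fromℕ n * x
  fromℕ-* n x = sym (trans (×-assoc-* n 1# x) (×-congʳ n (*-identityˡ x)))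

  x+x≈0⇒x≈0 : ∀ {x} → x + x ≈ 0# → x ≈ 0#
  x+x≈0⇒x≈0 {x} p = *-cancelˡ (fromℕ≉0 2) (begin
    fromℕ 2 * x    ≈⟨ fromℕ-* 2 x ⟨
    x + (x + 0#)   ≈⟨ +-congˡ (+-identityʳ x) ⟩
    x + x          ≈⟨ p ⟩
    0#             ≈⟨ zeroʳ (fromℕ 2) ⟨
    fromℕ 2 * 0#   ∎)

  x≈-x⇒x≈0 : ∀ {x} → x ≈ - x → x ≈ 0#
  x≈-x⇒x≈0 {x} p = x+x≈0⇒x≈0 (trans (+-congˡ p) (-‿inverseʳ x))

  sum-const : ∀ n x → sum {n} (λ _ → x) ≈ fromℕ n * x
  sum-const n x = trans (sum-replicate n) (fromℕ-* n x)

  sum-neg : ∀ {n} (f : Fin n → Carrier) → sum (λ i → - f i) ≈ - sum f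
  sum-neg f = begin
    sum (λ i → - f i)      ≈⟨ sum-cong-≋ (λ i → -1*x≈-x (f i)) ⟨
    sum (λ i → - 1# * f i) ≈⟨ *-distribˡ-sum (- 1#) f ⟨
    - 1# * sum f           ≈⟨ -1*x≈-x (sum f) ⟩
    - sum f                ∎

  ∑-distrib-- : ∀ {n} (f g : Fin n → Carrier) →
                sum (λ i → f i - g i) ≈ sum f - sum g
  ∑-distrib-- f g = trans (∑-distrib-+ f (λ i → - g i)) (+-congˡ (sum-neg g))

  sum-zero : ∀ {n} {f : Fin n → Carrier} → (∀ i → f i ≈ 0#) → sum f ≈ 0#
  sum-zero {n} p = trans (sum-cong-≋ p) (sum-replicate-zero n)

  indicator : Bool → Carrier
  indicator b = if b then 1# else 0#

  -- `d` is any function with the values of an indicator, which covers both `e` along an enumeration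
  -- and `δ` on the copies.
  sum-δ : ∀ {n} (j : Fin n) {d f : Fin n → Carrier} → d j ≈ 1# →
          (∀ i → i ≢ j → d i ≈ 0#) → sum (λ i → d i * f i) ≈ f j
  sum-δ {ℕ.suc n} j {d} {f} dj≈1 d≈0 = begin
    sum (λ i → d i * f i)
      ≈⟨ sum-remove {i = j} (λ i → d i * f i) ⟩
    d j * f j + sum (λ i → d (punchIn j i) * f (punchIn j i))
      ≈⟨ +-cong (trans (*-congʳ dj≈1) (*-identityˡ (f j)))
           (sum-zero λ i → trans (*-congʳ (d≈0 _ (Fin.punchInᵢ≢i j i))) (zeroˡ _)) ⟩
    f j + 0#
      ≈⟨ +-identityʳ (f j) ⟩
    f j ∎

  -- Eigenprojections of an arbitrary graph.

  module _ (X : Graph) where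
    open Graph X using (vertex; vertices; _≟_)

    private
      infix 4 _≋_
      infix 8 _∙_
      infixr 9 _·_
      _≋_ = Laplacian._≋_ ℝ X
      _∙_ = Laplacian._∙_ ℝ X
      _·_ = Laplacian._·_ ℝ X
      -ᵛ_ = Laplacian.-ᵛ_ ℝ X

    e-same : ∀ u → e X u u ≈ 1#
    e-same u = reflexive (≡.cong indicator (Dec.dec-true (u ≟ u) ≡.refl))

    e-distinct : ∀ {u v} → u ≢ v → e X u v ≈ 0#
    e-distinct {u} {v} u≢v = reflexive (≡.cong indicator (Dec.dec-false (u ≟ v) u≢v))

    ∙-comm : ∀ x y → x ∙ y ≈ y ∙ x
    ∙-comm x y = sum-cong-≋ λ i → *-comm (x (vertex i)) (y (vertex i))

    e-∙ : ∀ u x → e X u ∙ x ≈ x u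
    e-∙ u x = trans
      (sum-δ (to u)
        (trans (reflexive (≡.cong (e X u) (strictlyInverseʳ u))) (e-same u))
        (λ i i≢u → e-distinct λ p →
          i≢u (≡.trans (≡.sym (strictlyInverseˡ i)) (≡.cong to (≡.sym p)))))
      (reflexive (≡.cong x (strictlyInverseʳ u)))
      where open Inverse vertices using (to; strictlyInverseʳ; strictlyInverseˡ)

    L-· : ∀ x u → (L X · x) u ≈ fromℕ (degree X u) * x u - (A X · x) u
    L-· x u = begin
      sum (λ i → (D X u (vertex i) - A X u (vertex i)) * x (vertex i))
        ≈⟨ sum-cong-≋ (λ i → [y-z]x≈yx-zx (x (vertex i)) (D X u (vertex i)) (A X u (vertex i))) ⟩
      sum (λ i → D X u (vertex i) * x (vertex i) - A X u (vertex i) * x (vertex i))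
        ≈⟨ ∑-distrib-- (λ i → D X u (vertex i) * x (vertex i)) _ ⟩
      (D X · x) u - (A X · x) u
        -- Row `u` of the degree matrix is `d` times `e X u`.
        ≈⟨ +-congʳ (sum-cong-≋ λ i → trans (*-congʳ (scale (does (u ≟ vertex i))))
             (*-assoc d (e X u (vertex i)) (x (vertex i)))) ⟩
      sum (λ i → d * (e X u (vertex i) * x (vertex i))) - (A X · x) u
        ≈⟨ +-congʳ (*-distribˡ-sum d (λ i → e X u (vertex i) * x (vertex i))) ⟨
      d * (e X u ∙ x) - (A X · x) u
        ≈⟨ +-congʳ (*-congˡ (e-∙ u x)) ⟩
      d * x u - (A X · x) u ∎
      where
      d = fromℕ (degree X u)
      scale : ∀ b → (if b then d else 0#) ≈ d * indicator b
      scale true  = sym (*-identityʳ d)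
      scale false = sym (zeroʳ d)

    eigenspace-cong : ∀ {μ ν x} → μ ≈ ν → Eigenspace X μ x → Eigenspace X ν x
    eigenspace-cong p q u = trans (q u) (*-congʳ p)

    module _ (μ : Carrier) where
      open Laplacian.IsOrthogonalProjection (proj₂ (Laplacian.eigenprojection ℝ X μ))

      E-∙ : ∀ x w → Eigenspace X μ w → (E X μ · x) ∙ w ≈ x ∙ w
      E-∙ x w p = sym (x∙y⁻¹≈ε⇒x≈y (x ∙ w) ((E X μ · x) ∙ w) (begin
        x ∙ w - (E X μ · x) ∙ w
          ≈⟨ ∑-distrib-- (λ i → x (vertex i) * w (vertex i)) _ ⟨
        sum (λ i → x (vertex i) * w (vertex i) - (E X μ · x) (vertex i) * w (vertex i))
          ≈⟨ sum-cong-≋ (λ i → [y-z]x≈yx-zx (w (vertex i)) (x (vertex i)) ((E X μ · x) (vertex i))) ⟨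
        sum (λ i → (x (vertex i) - (E X μ · x) (vertex i)) * w (vertex i))
          ≈⟨ orthogonal x w p ⟩
        0# ∎))

      E-e-∙ : ∀ u w → Eigenspace X μ w → (E X μ · e X u) ∙ w ≈ w u
      E-e-∙ u w p = trans (E-∙ (e X u) w p) (e-∙ u w)

      E-e-eigenspace : ∀ u → Eigenspace X μ (E X μ · e X u)
      E-e-eigenspace u = range (e X u)

      -- Both entries equal the inner product of the two projected vectors, since each of these
      -- represents evaluation at its vertex. Hence any entry of one projected vector is the value
      -- at `u` of another eigenvector.
      E-e-sym : ∀ u v → (E X μ · e X u) v ≈ (E X μ · e X v) u
      E-e-sym u v = begin
        (E X μ · e X u) v                     ≈⟨ E-e-∙ v (E X μ · e X u) (E-e-eigenspace u) ⟨
        (E X μ · e X v) ∙ (E X μ · e X u)     ≈⟨ ∙-comm (E X μ · e X v) (E X μ · e X u) ⟩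
        (E X μ · e X u) ∙ (E X μ · e X v)     ≈⟨ E-e-∙ u (E X μ · e X v) (E-e-eigenspace v) ⟩
        (E X μ · e X v) u                     ∎

      -- Support and strong cospectrality in terms of eigenvectors.

      Vanishing : Vertex X → Set _
      Vanishing u = ∀ w → Eigenspace X μ w → w u ≈ 0#

      -- This and the next two equivalences have one pattern. Forwards, both sides are paired with
      -- `w`. Backwards, it is enough to test the eigenvectors that are projections of basis
      -- vectors, and `E-e-sym` turns their values at `u` into the entries wanted.
      E-e-≋0⇔ : ∀ u → (E X μ · e X u ≋ λ _ → 0#) ⇔ Vanishing u
      E-e-≋0⇔ u = mk⇔
        (λ p w q → begin
          w u                   ≈⟨ E-e-∙ u w q ⟨
          (E X μ · e X u) ∙ w   ≈⟨ sum-zero (λ i → trans (*-congʳ (p (vertex i))) (zeroˡ (w (vertex i)))) ⟩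
          0#                    ∎)
        (λ p v → trans (E-e-sym u v) (p (E X μ · e X v) (E-e-eigenspace v)))

      E-e-≋⇔ : ∀ u v → (E X μ · e X u ≋ E X μ · e X v) ⇔
                         (∀ w → Eigenspace X μ w → w u ≈ w v)
      E-e-≋⇔ u v = mk⇔
        (λ p w q → begin
          w u                   ≈⟨ E-e-∙ u w q ⟨
          (E X μ · e X u) ∙ w   ≈⟨ sum-cong-≋ (λ i → *-congʳ (p (vertex i))) ⟩
          (E X μ · e X v) ∙ w   ≈⟨ E-e-∙ v w q ⟩
          w v                   ∎)
        (λ p k → begin
          (E X μ · e X u) k     ≈⟨ E-e-sym u k ⟩
          (E X μ · e X k) u     ≈⟨ p (E X μ · e X k) (E-e-eigenspace k) ⟩
          (E X μ · e X k) v     ≈⟨ E-e-sym k v ⟩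
          (E X μ · e X v) k     ∎)

      E-e-≋-⇔ : ∀ u v → (E X μ · e X u ≋ -ᵛ (E X μ · e X v)) ⇔
                          (∀ w → Eigenspace X μ w → w u ≈ - w v)
      E-e-≋-⇔ u v = mk⇔
        (λ p w q → begin
          w u                       ≈⟨ E-e-∙ u w q ⟨
          (E X μ · e X u) ∙ w       ≈⟨ sum-cong-≋ (λ i → trans (*-congʳ (p (vertex i)))
                                         (sym (-‿distribˡ-* ((E X μ · e X v) (vertex i)) (w (vertex i))))) ⟩
          sum (λ i → - ((E X μ · e X v) (vertex i) * w (vertex i)))
                                    ≈⟨ sum-neg (λ i → (E X μ · e X v) (vertex i) * w (vertex i)) ⟩
          - ((E X μ · e X v) ∙ w)   ≈⟨ -‿cong (E-e-∙ v w q) ⟩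
          - w v                     ∎)
        (λ p k → begin
          (E X μ · e X u) k     ≈⟨ E-e-sym u k ⟩
          (E X μ · e X k) u     ≈⟨ p (E X μ · e X k) (E-e-eigenspace k) ⟩
          - (E X μ · e X k) v   ≈⟨ -‿cong (E-e-sym k v) ⟩
          - (E X μ · e X v) k   ∎)

      support⇔ : ∀ u → support X u μ ⇔ (¬ Vanishing u)
      support⇔ u = mk⇔
        (λ (_ , E≉0) p → E≉0 (Equivalence.from (E-e-≋0⇔ u) p))
        (λ p → let E≉0 = p ∘ Equivalence.to (E-e-≋0⇔ u) in
          -- The projected basis vector is itself the nonzero eigenvector that puts `μ` in `σ`.
          (E X μ · e X u , E≉0 , E-e-eigenspace u) , E≉0)

      nonzero⇒support : ∀ u w → Eigenspace X μ w → ¬ w u ≈ 0# → support X u μ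
      nonzero⇒support u w p wu≉0 = Equivalence.from (support⇔ u) λ q → wu≉0 (q w p)

  -- Laplacian eigenvectors of the blow-up.

  module _ (n : ℕ) (G : Graph) where
    open Graph G using (vertex)

    private
      ↑G = ↑ n G
      N = fromℕ n
      infixr 9 _·_ _·ᴳ_
      _·_  = Laplacian._·_ ℝ ↑G
      _·ᴳ_ = Laplacian._·_ ℝ G

    fibreSum : ℝᵛ ↑G → ℝᵛ G
    fibreSum x v = sum λ l → x (l , v)

    -- Adjacency ignores the copies, so after exchanging the two sums the sum over copies acts on
    -- `x` alone.
    A-↑ : ∀ x l v → (A ↑G · x) (l , v) ≈ (A G ·ᴳ fibreSum x) v
    A-↑ x l v = begin
      (A ↑G · x) (l , v)
        ≈⟨ sum-vertex-↑ +-commutativeMonoid n G (λ (k , w) → A G v w * x (k , w)) ⟩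
      sum {n} (λ k → sum λ j → A G v (vertex j) * x (k , vertex j))
        ≈⟨ ∑-comm {n} (λ k j → A G v (vertex j) * x (k , vertex j)) ⟩
      sum (λ j → sum {n} λ k → A G v (vertex j) * x (k , vertex j))
        ≈⟨ sum-cong-≋ (λ j → *-distribˡ-sum (A G v (vertex j)) (λ k → x (k , vertex j))) ⟨
      (A G ·ᴳ fibreSum x) v ∎

    L-↑ : ∀ x l v → (L ↑G · x) (l , v) ≈
          N * (fromℕ (degree G v) * x (l , v)) - (A G ·ᴳ fibreSum x) v
    L-↑ x l v = begin
      (L ↑G · x) (l , v)
        ≈⟨ L-· ↑G x (l , v) ⟩
      fromℕ (degree ↑G (l , v)) * x (l , v) - (A ↑G · x) (l , v)
        ≈⟨ +-cong (*-congʳ (trans (reflexive (≡.cong fromℕ (degree-↑ n G l v)))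
             (×1-homo-* n (degree G v)))) (-‿cong (A-↑ x l v)) ⟩
      N * fromℕ (degree G v) * x (l , v) - (A G ·ᴳ fibreSum x) v
        ≈⟨ +-congʳ (*-assoc _ _ _) ⟩
      N * (fromℕ (degree G v) * x (l , v)) - (A G ·ᴳ fibreSum x) v ∎

    -- Adding the eigenvalue equations over the `n` copies of `v` gives `n` times the equation for
    -- the fibre sums in `G`; the factor is then cancelled.
    fibreSum-eigenspace : .{{NonZero n}} → ∀ {μ x} →
      Eigenspace ↑G (N * μ) x → Eigenspace G μ (fibreSum x)
    fibreSum-eigenspace {μ} {x} p v = *-cancelˡ (fromℕ≉0 n) (begin
      N * (L G ·ᴳ s) v
        ≈⟨ *-congˡ (L-· G s v) ⟩
      N * (d * s v - a)
        ≈⟨ x[y-z]≈xy-xz N (d * s v) a ⟩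
      N * (d * s v) - N * a
        ≈⟨ +-cong (trans (*-congˡ (*-distribˡ-sum d (λ l → x (l , v))))
             (*-distribˡ-sum N (λ l → d * x (l , v)))) (-‿cong (sym (sum-const n a))) ⟩
      sum (λ l → N * (d * x (l , v))) - sum {n} (λ _ → a)
        ≈⟨ ∑-distrib-- (λ l → N * (d * x (l , v))) (λ _ → a) ⟨
      sum (λ l → N * (d * x (l , v)) - a)
        ≈⟨ sum-cong-≋ (λ l → trans (sym (L-↑ x l v)) (p (l , v))) ⟩
      sum (λ l → N * μ * x (l , v))
        ≈⟨ *-distribˡ-sum (N * μ) (λ l → x (l , v)) ⟨
      N * μ * s v
        ≈⟨ *-assoc N μ (s v) ⟩
      N * (μ * s v) ∎)
      where
      s = fibreSum x
      d = fromℕ (degree G v)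
      a = (A G ·ᴳ s) v

    -- A vector that is constant on fibres has fibre sum `N * y`, so the degree term and the
    -- adjacency term both acquire the factor `N`.
    lift-eigenspace : ∀ {μ y} → Eigenspace G μ y → Eigenspace ↑G (N * μ) (y ∘ proj₂)
    lift-eigenspace {μ} {y} p (l , v) = begin
      (L ↑G · (y ∘ proj₂)) (l , v)
        ≈⟨ L-↑ (y ∘ proj₂) l v ⟩
      N * (d * y v) - (A G ·ᴳ fibreSum (y ∘ proj₂)) v
        ≈⟨ +-congˡ (-‿cong (sum-cong-≋ λ j → trans (*-congˡ (sum-const n (y (vertex j))))
             (swap (A G v (vertex j)) N (y (vertex j))))) ⟩
      N * (d * y v) - sum (λ j → N * (A G v (vertex j) * y (vertex j)))
        ≈⟨ +-congˡ (-‿cong (*-distribˡ-sum N (λ j → A G v (vertex j) * y (vertex j)))) ⟨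
      N * (d * y v) - N * (A G ·ᴳ y) v
        ≈⟨ x[y-z]≈xy-xz N (d * y v) ((A G ·ᴳ y) v) ⟨
      N * (d * y v - (A G ·ᴳ y) v)
        ≈⟨ *-congˡ (trans (sym (L-· G y v)) (p v)) ⟩
      N * (μ * y v)
        ≈⟨ *-assoc N μ (y v) ⟨
      N * μ * y v ∎
      where
      d = fromℕ (degree G v)
      swap : ∀ a b c → a * (b * c) ≈ b * (a * c)
      swap a b c = trans (sym (*-assoc a b c)) (trans (*-congʳ (*-comm a b)) (*-assoc b a c))

    -- (n d_v − μ) x(l,v) is the v-entry of A · fibreSum x, whatever l is.
    eigenspace-constant-on-fibre : ∀ {μ x v} → Eigenspace ↑G μ x →
      ¬ μ ≈ N * fromℕ (degree G v) → ∀ l m → x (l , v) ≈ x (m , v)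
    eigenspace-constant-on-fibre {μ} {x} {v} p μ≉Nd l m =
      *-cancelˡ Nd-μ≉0 (trans (entry l) (sym (entry m)))
      where
      d = fromℕ (degree G v)
      a = (A G ·ᴳ fibreSum x) v
      Nd-μ≉0 : ¬ N * d - μ ≈ 0#
      Nd-μ≉0 q = μ≉Nd (sym (x∙y⁻¹≈ε⇒x≈y (N * d) μ q))
      entry : ∀ l → (N * d - μ) * x (l , v) ≈ a
      entry l = begin
        (N * d - μ) * x (l , v)                   ≈⟨ [y-z]x≈yx-zx (x (l , v)) (N * d) μ ⟩
        N * d * x (l , v) - μ * x (l , v)         ≈⟨ +-cong (*-assoc N d (x (l , v)))
                                                       (-‿cong (trans (sym (p (l , v))) (L-↑ x l v))) ⟩
        b - (b - a)                               ≈⟨ trans (+-congˡ (⁻¹-anti-homo‿- b a)) (trans (sym (+-assoc b a (- b))) (xyx⁻¹≈y b a)) ⟩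
        a                                         ∎
        where b = N * (d * x (l , v))

    -- The fibre sums are zero, so the adjacency term drops out. Away from `u` the vector is zero,
    -- so the degree of `v` may be replaced by that of `u`.
    fibre-eigenspace : ∀ {a : Fin n → Carrier} u → sum a ≈ 0# →
      Eigenspace ↑G (N * fromℕ (degree G u)) (λ (l , v) → a l * e G u v)
    fibre-eigenspace {a} u ∑a≈0 (l , v) = begin
      (L ↑G · w) (l , v)
        ≈⟨ L-↑ w l v ⟩
      N * (fromℕ (degree G v) * w (l , v)) - (A G ·ᴳ fibreSum w) v
        ≈⟨ +-cong (*-congˡ (same-degree (Graph._≟_ G u v))) (-‿cong
             (sum-zero λ j → trans (*-congˡ (fibreSum≈0 (vertex j))) (zeroʳ (A G v (vertex j))))) ⟩
      N * (fromℕ (degree G u) * w (l , v)) - 0#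
        ≈⟨ trans (+-congˡ -0#≈0#) (+-identityʳ _) ⟩
      N * (fromℕ (degree G u) * w (l , v))
        ≈⟨ *-assoc N (fromℕ (degree G u)) (w (l , v)) ⟨
      N * fromℕ (degree G u) * w (l , v) ∎
      where
      w : ℝᵛ ↑G
      w (l , v) = a l * e G u v
      fibreSum≈0 : ∀ v → fibreSum w v ≈ 0#
      fibreSum≈0 v = trans (sym (*-distribʳ-sum (e G u v) a))
        (trans (*-congʳ ∑a≈0) (zeroˡ (e G u v)))
      same-degree : Dec (u ≡ v) →
        fromℕ (degree G v) * w (l , v) ≈ fromℕ (degree G u) * w (l , v)
      same-degree (yes ≡.refl) = refl
      same-degree (no u≢v) = trans (trans (*-congˡ w≈0) (zeroʳ (fromℕ (degree G v))))
        (sym (trans (*-congˡ w≈0) (zeroʳ (fromℕ (degree G u)))))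
        where
        w≈0 : w (l , v) ≈ 0#
        w≈0 = trans (*-congˡ (e-distinct G u≢v)) (zeroʳ (a l))

    -- Eigenvectors living on two copies of one vertex.

    δ : Fin n → Fin n → Carrier
    δ l m = indicator (does (l Fin.≟ m))

    δ-same : ∀ l → δ l l ≈ 1#
    δ-same l = reflexive (≡.cong indicator (Dec.dec-true (l Fin.≟ l) ≡.refl))

    δ-distinct : ∀ l m → l ≢ m → δ l m ≈ 0#
    δ-distinct l m l≢m = reflexive (≡.cong indicator (Dec.dec-false (l Fin.≟ m) l≢m))

    ∑δ≈1 : ∀ l → sum (δ l) ≈ 1#
    ∑δ≈1 l = trans (sum-cong-≋ λ m → sym (*-identityʳ (δ l m)))
      (sum-δ l (δ-same l) λ m m≢l → δ-distinct l m (m≢l ∘ ≡.sym))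

    -- This is e_(l,u) - e_(k,u), factored so as to be an instance of `fibre-eigenspace`.
    difference : Fin n → Fin n → Vertex G → ℝᵛ ↑G
    difference l k u (m , v) = (δ l m - δ k m) * e G u v

    difference-eigenspace : ∀ l k u →
      Eigenspace ↑G (N * fromℕ (degree G u)) (difference l k u)
    difference-eigenspace l k u = fibre-eigenspace {λ m → δ l m - δ k m} u (begin
      sum (λ m → δ l m - δ k m) ≈⟨ ∑-distrib-- (δ l) (δ k) ⟩
      sum (δ l) - sum (δ k)     ≈⟨ +-cong (∑δ≈1 l) (-‿cong (∑δ≈1 k)) ⟩
      1# - 1#                   ≈⟨ -‿inverseʳ 1# ⟩
      0#                        ∎)

    difference-at-first : ∀ l k u → l ≢ k → difference l k u (l , u) ≈ 1#
    difference-at-first l k u l≢k = begin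
      (δ l l - δ k l) * e G u u
        ≈⟨ *-cong (+-cong (δ-same l) (-‿cong (δ-distinct k l (l≢k ∘ ≡.sym)))) (e-same G u) ⟩
      (1# - 0#) * 1#  ≈⟨ *-identityʳ (1# - 0#) ⟩
      1# - 0#         ≈⟨ trans (+-congˡ -0#≈0#) (+-identityʳ 1#) ⟩
      1#              ∎

    difference-at-second : ∀ l k u → l ≢ k → difference l k u (k , u) ≈ - 1#
    difference-at-second l k u l≢k = begin
      (δ l k - δ k k) * e G u u
        ≈⟨ *-cong (+-cong (δ-distinct l k l≢k) (-‿cong (δ-same k))) (e-same G u) ⟩
      (0# - 1#) * 1#  ≈⟨ *-identityʳ (0# - 1#) ⟩
      0# - 1#         ≈⟨ +-identityˡ (- 1#) ⟩
      - 1#            ∎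

    difference-elsewhere : ∀ l k u y → (l , u) ≢ y → (k , u) ≢ y →
                           difference l k u y ≈ 0#
    difference-elsewhere l k u (m , v) lu≢y ku≢y with Graph._≟_ G u v
    ... | no u≢v = trans (*-congˡ (e-distinct G u≢v)) (zeroʳ (δ l m - δ k m))
    ... | yes ≡.refl = begin
      (δ l m - δ k m) * e G u u ≈⟨ trans (*-congˡ (e-same G u)) (*-identityʳ (δ l m - δ k m)) ⟩
      δ l m - δ k m             ≈⟨ +-cong (δ-distinct l m λ { ≡.refl → lu≢y ≡.refl })
                                (-‿cong (δ-distinct k m λ { ≡.refl → ku≢y ≡.refl })) ⟩
      0# - 0#                   ≈⟨ -‿inverseʳ 0# ⟩
      0#                        ∎

    difference-support : ∀ l k u → l ≢ k →
                         support ↑G (l , u) (N * fromℕ (degree G u))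
    difference-support l k u l≢k =
      nonzero⇒support ↑G (N * fromℕ (degree G u)) (l , u) (difference l k u)
        (difference-eigenspace l k u)
        λ p → 1≉0 (trans (sym (difference-at-first l k u l≢k)) p)

    -- The vector `difference l k u` is 1 at `(l , u)` and 0 at `y`, so either sign in the
    -- definition of strong cospectrality would give 1 = 0.
    not-cospectral-outside-pair : ∀ {l k u y} → l ≢ k → (l , u) ≢ y → (k , u) ≢ y →
                             ¬ StronglyCospectral ↑G (l , u) y
    not-cospectral-outside-pair {l} {k} {u} {y} l≢k lu≢y ku≢y cospectral
      with cospectral (N * fromℕ (degree G u)) (difference-support l k u l≢k)
    ... | inj₁ p = 1≉0 (begin
      1#                          ≈⟨ difference-at-first l k u l≢k ⟨
      difference l k u (l , u)    ≈⟨ Equivalence.to (E-e-≋⇔ ↑G (N * fromℕ (degree G u)) (l , u) y) p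
                                       (difference l k u) (difference-eigenspace l k u) ⟩
      difference l k u y          ≈⟨ difference-elsewhere l k u y lu≢y ku≢y ⟩
      0#                          ∎)
    ... | inj₂ p = 1≉0 (begin
      1#                          ≈⟨ difference-at-first l k u l≢k ⟨
      difference l k u (l , u)    ≈⟨ Equivalence.to (E-e-≋-⇔ ↑G (N * fromℕ (degree G u)) (l , u) y) p
                                       (difference l k u) (difference-eigenspace l k u) ⟩
      - difference l k u y        ≈⟨ -‿cong (difference-elsewhere l k u y lu≢y ku≢y) ⟩
      - 0#                        ≈⟨ -0#≈0# ⟩
      0#                          ∎)

  -- Three or more copies.

  no-cospectral-pair : ∀ G n → n ≥ 3 → (x y : Vertex (↑ n G)) → x ≢ y →
                       ¬ StronglyCospectral (↑ n G) x y
  no-cospectral-pair G (ℕ.suc (ℕ.suc (ℕ.suc n))) (ℕ.s≤s (ℕ.s≤s (ℕ.s≤s _))) (l , u) (m , v) x≢y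
    -- The second vertex differs from `(l , u)` by assumption and from `(k , u)` in its copy,
    -- whether or not `u` and `v` coincide.
    with avoid₂ l m
  ... | k , l≢k , m≢k = not-cospectral-outside-pair (3 ℕ.+ n) G l≢k x≢y
    (m≢k ∘ ≡.sym ∘ ≡.cong proj₁)

  -- Two copies: the twins `u₀` and `u₁`.

  module _ (G : Graph) (u : Vertex G) where

    private
      ↑²G = ↑ 2 G
      d = fromℕ (degree G u)
      u₀ u₁ : Vertex ↑²G
      u₀ = 0F , u
      u₁ = 1F , u
      diff = difference 2 G 0F 1F u

    cospectral-only-with-twin : ∀ x → x ≢ u₀ → StronglyCospectral ↑²G u₀ x → x ≡ u₁
    cospectral-only-with-twin x x≢u₀ cospectral with Graph._≟_ ↑²G x u₁
    ... | yes x≡u₁ = x≡u₁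
    ... | no x≢u₁ = contradiction cospectral
      (not-cospectral-outside-pair 2 G (λ ()) (x≢u₀ ∘ ≡.sym) (x≢u₁ ∘ ≡.sym))

    constant-on-twins : ∀ {μ} → ¬ μ ≈ fromℕ 2 * d → ∀ x → Eigenspace ↑²G μ x → x u₀ ≈ x u₁
    constant-on-twins μ≉2d x p = eigenspace-constant-on-fibre 2 G p μ≉2d 0F 1F

    alternating-on-twins : d ∉ support G u → ∀ {μ} → μ ≈ fromℕ 2 * d →
                    ∀ x → Eigenspace ↑²G μ x → x u₀ ≈ - x u₁
    alternating-on-twins d∉ μ≈2d x p = +-inverseˡ-unique (x u₀) (x u₁)
      -- The fibre sum over `Fin 2` unfolds with a final `+ 0#`. If it were nonzero at `u`, it would
      -- be an eigenvector witnessing that `d` is in the support.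
      (trans (+-congˡ (sym (+-identityʳ (x u₁))))
        (≈-stable λ ∑≉0 → d∉ (nonzero⇒support G d u (fibreSum 2 G x)
          (fibreSum-eigenspace 2 G (eigenspace-cong ↑²G μ≈2d p)) ∑≉0)))

    -- At the eigenvalue `2d` the plus sign fails on `diff`, whose values on the twins are 1 and -1.
    -- The minus sign makes every lifted eigenvector, being equal on the twins, vanish at `u`,
    -- against `d` being in the support.
    cospectral⇒∉support : StronglyCospectral ↑²G u₀ u₁ → d ∉ support G u
    cospectral⇒∉support cospectral d∈
      with cospectral (fromℕ 2 * d) (difference-support 2 G 0F 1F u (λ ()))
    ... | inj₁ p = 1≉0 (x≈-x⇒x≈0 (begin
      1#        ≈⟨ difference-at-first 2 G 0F 1F u (λ ()) ⟨
      diff u₀   ≈⟨ Equivalence.to (E-e-≋⇔ ↑²G (fromℕ 2 * d) u₀ u₁) p diff (difference-eigenspace 2 G 0F 1F u) ⟩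
      diff u₁   ≈⟨ difference-at-second 2 G 0F 1F u (λ ()) ⟩
      - 1#      ∎))
    ... | inj₂ p = Equivalence.to (support⇔ G d u) d∈ λ y q →
      x≈-x⇒x≈0 (Equivalence.to (E-e-≋-⇔ ↑²G (fromℕ 2 * d) u₀ u₁) p
        (y ∘ proj₂) (lift-eigenspace 2 G q))

    ∉support⇒cospectral : d ∉ support G u → StronglyCospectral ↑²G u₀ u₁
    ∉support⇒cospectral d∉ μ _ with μ ≈? fromℕ 2 * d
    ... | yes μ≈2d = inj₂ (Equivalence.from (E-e-≋-⇔ ↑²G μ u₀ u₁) (alternating-on-twins d∉ μ≈2d))
    ... | no μ≉2d  = inj₁ (Equivalence.from (E-e-≋⇔ ↑²G μ u₀ u₁) (constant-on-twins μ≉2d))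

    σ⁺-twins : d ∉ support G u → σ⁺ ↑²G u₀ u₁ ≐ 2· support G u
    σ⁺-twins d∉ = to , from
      where
      half : ∃ λ h → fromℕ 2 * h ≈ 1#
      half = inverse (fromℕ 2) (fromℕ≉0 2)

      to : ∀ {μ} → σ⁺ ↑²G u₀ u₁ μ → (2· support G u) μ
      -- Here `s` is half of `μ`. If all eigenvectors of `G` for `s` vanished at `u`, so would the
      -- fibre sum of each `x`, which is twice `x u₀` by the plus sign.
      to {μ} (_ , E≋ , E≉0) = s , Equivalence.from (support⇔ G s u)
        (λ p → E≉0 (Equivalence.from (E-e-≋0⇔ ↑²G μ u₀) λ x q → x+x≈0⇒x≈0 (begin
          x u₀ + x u₀          ≈⟨ +-congˡ (Equivalence.to (E-e-≋⇔ ↑²G μ u₀ u₁) E≋ x q) ⟩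
          x u₀ + x u₁          ≈⟨ +-congˡ (+-identityʳ (x u₁)) ⟨
          fibreSum 2 G x u     ≈⟨ p _ (fibreSum-eigenspace 2 G (eigenspace-cong ↑²G μ≈2s q)) ⟩
          0#                   ∎))) , μ≈2s
        where
        s = proj₁ half * μ
        μ≈2s : μ ≈ fromℕ 2 * s
        μ≈2s = sym (trans (sym (*-assoc (fromℕ 2) (proj₁ half) μ))
          (trans (*-congʳ (proj₂ half)) (*-identityˡ μ)))

      from : ∀ {μ} → (2· support G u) μ → σ⁺ ↑²G u₀ u₁ μ
      from {μ} (s , s∈ , μ≈2s) = proj₁ μ∈ ,
        Equivalence.from (E-e-≋⇔ ↑²G μ u₀ u₁) (constant-on-twins μ≉2d) , proj₂ μ∈
        where
        ¬vanishing = Equivalence.to (support⇔ G s u) s∈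
        μ≉2d : ¬ μ ≈ fromℕ 2 * d
        -- Equality would give `s ≈ d` after cancelling 2, and so put `d` in the support.
        μ≉2d μ≈2d = d∉ (Equivalence.from (support⇔ G d u) λ p → ¬vanishing λ y q →
          p y (eigenspace-cong G (*-cancelˡ (fromℕ≉0 2) (trans (sym μ≈2s) μ≈2d)) q))
        μ∈ : support ↑²G u₀ μ
        μ∈ = Equivalence.from (support⇔ ↑²G μ u₀) λ p → ¬vanishing λ y q →
          p (y ∘ proj₂) (eigenspace-cong ↑²G (sym μ≈2s) (lift-eigenspace 2 G q))

    σ⁻-twins : d ∉ support G u → σ⁻ ↑²G u₀ u₁ ≐ ｛ fromℕ 2 * d ｝
    σ⁻-twins d∉ = to , from
      where
      to : ∀ {μ} → σ⁻ ↑²G u₀ u₁ μ → μ ≈ fromℕ 2 * d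
      -- For any other `μ` the eigenvectors are equal on the twins as well as opposite, hence zero
      -- at `u₀`.
      to {μ} (_ , E≋- , E≉0) = ≈-stable λ μ≉2d →
        E≉0 (Equivalence.from (E-e-≋0⇔ ↑²G μ u₀) λ x p → x≈-x⇒x≈0 (trans
          (Equivalence.to (E-e-≋-⇔ ↑²G μ u₀ u₁) E≋- x p) (-‿cong (sym (constant-on-twins μ≉2d x p)))))

      from : ∀ {μ} → μ ≈ fromℕ 2 * d → σ⁻ ↑²G u₀ u₁ μ
      from {μ} μ≈2d = proj₁ μ∈ ,
        Equivalence.from (E-e-≋-⇔ ↑²G μ u₀ u₁) (alternating-on-twins d∉ μ≈2d) , proj₂ μ∈
        where
        μ∈ : support ↑²G u₀ μ
        μ∈ = nonzero⇒support ↑²G μ u₀ diff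
          (eigenspace-cong ↑²G (sym μ≈2d) (difference-eigenspace 2 G 0F 1F u))
          λ p → 1≉0 (trans (sym (difference-at-first 2 G 0F 1F u (λ ()))) p)

theorem2 : ∀ {c ℓ₁ ℓ₂} (ℝ : CompleteOrderedField c ℓ₁ ℓ₂) (G : Graph) →
    let open CompleteOrderedField ℝ using (_*_) in
    let open Laplacian ℝ in
    (∀ (n : ℕ) → n ≥ 3 → ∀ (x y : Vertex (↑ n G)) → x ≢ y →
    ¬ StronglyCospectral (↑ n G) x y)
    ×
    (∀ (u : Vertex G) →
    (StronglyCospectral (↑ 2 G) (0F , u) (1F , u) ⇔
    fromℕ (degree G u) ∉ support G u)
    ×
    (StronglyCospectral (↑ 2 G) (0F , u) (1F , u) →
    σ⁺ (↑ 2 G) (0F , u) (1F , u) ≐ 2· support G u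
    ×
    σ⁻ (↑ 2 G) (0F , u) (1F , u) ≐ ｛ fromℕ 2 * fromℕ (degree G u) ｝)
    ×
    (∀ (x : Vertex (↑ 2 G)) → x ≢ (0F , u) →
    StronglyCospectral (↑ 2 G) (0F , u) x → x ≡ (1F , u)))
theorem2 ℝ G = no-cospectral-pair ℝ G , λ u →
  mk⇔ (cospectral⇒∉support ℝ G u) (∉support⇒cospectral ℝ G u) ,
  (λ cospectral → σ⁺-twins ℝ G u (cospectral⇒∉support ℝ G u cospectral) ,
                  σ⁻-twins ℝ G u (cospectral⇒∉support ℝ G u cospectral)) ,
  cospectral-only-with-twin ℝ G u
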